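{- (Beth definability) Let $P$ be a unary predicate not in $L_{\infty\omega}^{corr}$, $\phi(P)$ a formula of $L_{\infty\omega}^{corr}\cup\{P\}$, and $K$ a class of Routley–Meyer structures defined by some formula $\psi$ of $L_{\infty\omega}^{corr}\cup\{P\}$. Then the following are equivalent: (i) There is a relevant formula $\theta(x)$ of $L_{\infty\omega}^{corr}$ such that $\theta(x)\equiv Px$ is a logical consequence of $\phi(P)$ in the standard classical sense. (ii) If $(M_1,w_1,P^{M_1})$ and $(M_2,w_2,P^{M_2})$ are models of $\phi(P)$ such that $\langle Z_1,Z_2\rangle$ is a relevant directed bisimulation between the restrictions $(M_1,w_1)$ and $(M_2,w_2)$ of $(M_1,w_1,P^{M_1})$ and $(M_2,w_2,P^{M_2})$ to $L_{\infty\omega}^{corr}$, then $\langle Z_1,Z_2\rangle$ is a relevant directed bisimulation between $(M_1,w_1,P^{M_1})$ and $(M_2,w_2,P^{M_2})$.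
   Context: Language. Given a set $\mathtt{PROP}$ of propositional variables, the formulas of $L_{\infty\omega}^{\rightarrow}$ are generated by $\phi ::= p \mid \bot \mid {\sim}\phi \mid \bigwedge_{i\in I}\phi_i \mid \bigvee_{i\in I}\phi_i \mid \phi\rightarrow\psi$, with $p\in\mathtt{PROP}$ and $I$ an arbitrary set. Models. A (Routley–Meyer) model or structure is $M=\langle W,R,*,T,V\rangle$ with $W$ a non-empty set, $T\in W$, $*:W\to W$ (written $w\mapsto w^*$), $R\subseteq W^3$, and $V:\mathtt{PROP}\to\wp(W)$. Satisfaction: $M,w\Vdash\bot$ never; $M,w\Vdash p$ iff $w\in V(p)$; $M,w\Vdash{\sim}\phi$ iff $M,w^*\nVdash\phi$; $M,w\Vdash\bigwedge_{i\in I}\phi_i$ iff $M,w\Vdash\phi_i$ for every $i\in I$; $M,w\Vdash\bigvee_{i\in I}\phi_i$ iff $M,w\Vdash\phi_i$ for some $i\in I$; $M,w\Vdash\phi\rightarrow\psi$ iff for all $a,b$ with $Rwab$, if $M,a\Vdash\phi$ then $M,b\Vdash\psi$. A pointed model $(M,w)$ is a model with a distinguished world $w\in W$. Correspondence language. $L_{\infty\omega}^{corr}$ is the classical infinitary language with equality (arbitrary set-sized conjunctions and disjunctions, boolean negation $\neg$, material implication $\supset$, finitary quantification) in the signature with a constant $T$, a unary function symbol $*$, a ternary relation symbol $R$ and a unary predicate $Q$ for each $q\in\mathtt{PROP}$. A model $M$ is read as a classical structure with domain $W$, interpreting $T,*,R$ in the obvious way and $Q$ by $V(q)$. $L_{\infty\omega}^{corr}\cup\{P\}$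 adds the unary predicate $P$ to the signature; $(M,w,P^M)$ denotes the expansion of the pointed model $(M,w)$ by an interpretation $P^M\subseteq W$ of $P$. A relevant formula of $L_{\infty\omega}^{corr}$ is the translation $T_x(\chi)$ of some formula $\chi$ of $L_{\infty\omega}^{\rightarrow}$, where $T_x(\bot)=\neg Rxxx\wedge Rxxx$; $T_x(q)=Qx$; $T_x({\sim}\phi)=\neg T_x(\phi)^{x^*/x}$; $T_x$ commutes with $\bigwedge$ and $\bigvee$; $T_x(\phi\rightarrow\psi)=\forall y,z\,(Rxyz\wedge T_x(\phi)^{y/x}\supset T_x(\psi)^{z/x})$; here $\chi^{t/x}$ is the result of replacing $x$ with $t$ in $\chi$. One has $M\vDash T_x(\chi)[w]$ iff $M,w\Vdash\chi$. Relevant directed bisimulations. Let $M_1,M_2$ be models with components $W_m,R_m,*_m,V_m$ ($m=1,2$). A relevant directed bisimulation for $\mathtt{PROP}$ between $M_1$ and $M_2$ is a pair $\langle Z_1,Z_2\rangle$ of non-empty relations $Z_1\subseteq W_1\times W_2$, $Z_2\subseteq W_2\times W_1$ such that whenever $\{i,j\}=\{1,2\}$: (1) $xZ_iy$ only if $y^{*_j}Z_jx^{*_i}$; (2) if $xZ_iy$ and $R_jybc$ for some $b,c\in W_j$, there are $b',c'\in W_i$ such that $R_ixb'c'$, $bZ_jb'$ and $c'Z_ic$; (3) if $xZ_iy$ and $p\in\mathtt{PROP}$, then $M_i,x\Vdash p$ only if $M_j,y\Vdash p$. Between the expanded structures $(M_1,w_1,P^{M_1})$ and $(M_2,w_2,P^{M_2})$,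 the predicate $P$ is treated as corresponding to a further propositional variable, so (3) additionally requires: if $xZ_iy$ and $x\in P^{M_i}$ then $y\in P^{M_j}$. -}

module Defs where

open import Data.Bool.Base using (Bool; if_then_else_)
open import Data.Empty using (⊥)
open import Data.Fin.Base using (Fin; zero; suc)
open import Data.Maybe.Base using (Maybe; just; nothing; maybe′)
open import Data.Nat.Base using (ℕ; zero; suc)
open import Data.Product.Base using (Σ; _×_; ∃; ∃₂)
open import Data.Vec.Base using (Vec; []; _∷_; lookup; map; allFin)
open import Relation.Binary.PropositionalEquality.Core using (_≡_)
open import Relation.Nullary.Negation.Core using (¬_)

-- "Set-sized" is read as "indexed by a type in Set" throughout.

infixr 5 _⇒_

data RFormula (PROP : Set) : Set₁ where
  var : PROP → RFormula PROP
  bot : RFormula PROP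
  ∼_  : RFormula PROP → RFormula PROP
  ⋀   : {I : Set} → (I → RFormula PROP) → RFormula PROP
  ⋁   : {I : Set} → (I → RFormula PROP) → RFormula PROP
  _⇒_ : RFormula PROP → RFormula PROP → RFormula PROP

-- Non-emptiness of W is witnessed by T.
record Model (PROP : Set) : Set₁ where
  field
    W    : Set
    R    : W → W → W → Set
    star : W → W
    T    : W
    V    : PROP → W → Set

open Model public

infix 4 _,_⊩_

_,_⊩_ : ∀ {PROP} (M : Model PROP) → W M → RFormula PROP → Set
M , w ⊩ var p   = V M p w
M , w ⊩ bot     = ⊥
M , w ⊩ (∼ φ)   = ¬ (M , star M w ⊩ φ)
M , w ⊩ ⋀ φ     = ∀ i → M , w ⊩ φ i
M , w ⊩ ⋁ φ     = ∃ λ i → M , w ⊩ φ i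
M , w ⊩ (φ ⇒ ψ) = ∀ a b → R M w a b → M , a ⊩ φ → M , b ⊩ ψ

-- Formula PROP n has its free variables among n de Bruijn indices; a binder
-- adds index zero.

data Term (n : ℕ) : Set where
  var   : Fin n → Term n
  const : Term n
  _⋆    : Term n → Term n

infixr 5 _⊃_

data Formula (PROP : Set) (n : ℕ) : Set₁ where
  pred : PROP → Term n → Formula PROP n
  rel  : Term n → Term n → Term n → Formula PROP n
  _≈_  : Term n → Term n → Formula PROP n
  neg  : Formula PROP n → Formula PROP n
  _⊃_  : Formula PROP n → Formula PROP n → Formula PROP n
  ⋀    : {I : Set} → (I → Formula PROP n) → Formula PROP n
  ⋁    : {I : Set} → (I → Formula PROP n) → Formula PROP n
  all  : Formula PROP (suc n) → Formula PROP n
  ex   : Formula PROP (suc n) → Formula PROP n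

infixr 6 _∧ᶠ_
infix  4 _≡ᶠ_

_∧ᶠ_ : ∀ {PROP n} → Formula PROP n → Formula PROP n → Formula PROP n
φ ∧ᶠ ψ = ⋀ {I = Bool} λ b → if b then φ else ψ

_≡ᶠ_ : ∀ {PROP n} → Formula PROP n → Formula PROP n → Formula PROP n
φ ≡ᶠ ψ = (φ ⊃ ψ) ∧ᶠ (ψ ⊃ φ)

⟦_⟧ : ∀ {PROP n} → Term n → (M : Model PROP) → Vec (W M) n → W M
⟦ var i ⟧ M ρ = lookup ρ i
⟦ const ⟧ M ρ = T M
⟦ t ⋆ ⟧   M ρ = star M (⟦ t ⟧ M ρ)

infix 4 _⊨_[_] _⊨_

_⊨_[_] : ∀ {PROP n} (M : Model PROP) → Formula PROP n → Vec (W M) n → Set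
M ⊨ pred q t  [ ρ ] = V M q (⟦ t ⟧ M ρ)
M ⊨ rel s t u [ ρ ] = R M (⟦ s ⟧ M ρ) (⟦ t ⟧ M ρ) (⟦ u ⟧ M ρ)
M ⊨ s ≈ t     [ ρ ] = ⟦ s ⟧ M ρ ≡ ⟦ t ⟧ M ρ
M ⊨ neg φ     [ ρ ] = ¬ (M ⊨ φ [ ρ ])
M ⊨ φ ⊃ ψ     [ ρ ] = M ⊨ φ [ ρ ] → M ⊨ ψ [ ρ ]
M ⊨ ⋀ φ       [ ρ ] = ∀ i → M ⊨ φ i [ ρ ]
M ⊨ ⋁ φ       [ ρ ] = ∃ λ i → M ⊨ φ i [ ρ ]
M ⊨ all φ     [ ρ ] = ∀ w → M ⊨ φ [ w ∷ ρ ]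
M ⊨ ex φ      [ ρ ] = ∃ λ w → M ⊨ φ [ w ∷ ρ ]

-- A structure is a model of a formula when the formula holds in it under
-- every assignment; for sentences there is only the empty assignment.
_⊨_ : ∀ {PROP n} → Model PROP → Formula PROP n → Set
M ⊨ φ = ∀ ρ → M ⊨ φ [ ρ ]

Mod : ∀ {PROP n} → Formula PROP n → Model PROP → Set
Mod ψ M = M ⊨ ψ

Consequence : ∀ {PROP m n} → (Model PROP → Set) →
              Formula PROP m → Formula PROP n → Set₁
Consequence K φ χ = ∀ M → K M → M ⊨ φ → M ⊨ χ

subᵗ : ∀ {m n} → Vec (Term n) m → Term m → Term n
subᵗ σ (var i) = lookup σ i
subᵗ σ const   = const
subᵗ σ (t ⋆)   = subᵗ σ t ⋆

lift : ∀ {m n} → Vec (Term n) m → Vec (Term (suc n)) (suc m)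
lift {n = n} σ =
  var zero ∷ map (subᵗ (map (λ i → var (suc i)) (allFin n))) σ

sub : ∀ {PROP m n} → Vec (Term n) m → Formula PROP m → Formula PROP n
sub σ (pred q t)  = pred q (subᵗ σ t)
sub σ (rel s t u) = rel (subᵗ σ s) (subᵗ σ t) (subᵗ σ u)
sub σ (s ≈ t)     = subᵗ σ s ≈ subᵗ σ t
sub σ (neg φ)     = neg (sub σ φ)
sub σ (φ ⊃ ψ)     = sub σ φ ⊃ sub σ ψ
sub σ (⋀ φ)       = ⋀ λ i → sub σ (φ i)
sub σ (⋁ φ)       = ⋁ λ i → sub σ (φ i)
sub σ (all φ)     = all (sub (lift σ) φ)
sub σ (ex φ)      = ex (sub (lift σ) φ)

infix 8 _⟨_⟩

_⟨_⟩ : ∀ {PROP n} → Formula PROP 1 → Term n → Formula PROP n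
χ ⟨ t ⟩ = sub (t ∷ []) χ

Tₓ : ∀ {PROP} → RFormula PROP → Formula PROP 1
Tₓ (var q) = pred q (var zero)
Tₓ bot     = neg Rxxx ∧ᶠ Rxxx
  where Rxxx = rel (var zero) (var zero) (var zero)
Tₓ (∼ φ)   = neg (Tₓ φ ⟨ var zero ⋆ ⟩)
Tₓ (⋀ φ)   = ⋀ λ i → Tₓ (φ i)
Tₓ (⋁ φ)   = ⋁ λ i → Tₓ (φ i)
Tₓ (φ ⇒ ψ) = all (all (rel x y z ∧ᶠ Tₓ φ ⟨ y ⟩ ⊃ Tₓ ψ ⟨ z ⟩))
  where
  x y z : Term 3
  x = var (suc (suc zero))
  y = var (suc zero)
  z = var zero

Relevant : ∀ {PROP} → Formula PROP 1 → Set₁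
Relevant θ = ∃ λ χ → θ ≡ Tₓ χ

-- Maybe PROP is the signature with the new predicate P added: P = nothing.

embed : ∀ {PROP n} → Formula PROP n → Formula (Maybe PROP) n
embed (pred q t)  = pred (just q) t
embed (rel s t u) = rel s t u
embed (s ≈ t)     = s ≈ t
embed (neg φ)     = neg (embed φ)
embed (φ ⊃ ψ)     = embed φ ⊃ embed ψ
embed (⋀ φ)       = ⋀ λ i → embed (φ i)
embed (⋁ φ)       = ⋁ λ i → embed (φ i)
embed (all φ)     = all (embed φ)
embed (ex φ)      = ex (embed φ)

Px : ∀ {PROP} → Formula (Maybe PROP) 1
Px = pred nothing (var zero)

expand : ∀ {PROP} (M : Model PROP) → (W M → Set) → Model (Maybe PROP)
expand M P = record
  { W    = W M
  ; R    = R M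
  ; star = star M
  ; T    = T M
  ; V    = maybe′ (V M) P
  }

record Directed {PROP} (Mᵢ Mⱼ : Model PROP)
                (Zᵢ : W Mᵢ → W Mⱼ → Set) (Zⱼ : W Mⱼ → W Mᵢ → Set) : Set where
  field
    star-clause : ∀ {x y} → Zᵢ x y → Zⱼ (star Mⱼ y) (star Mᵢ x)
    back-clause : ∀ {x y b c} → Zᵢ x y → R Mⱼ y b c →
                  ∃₂ λ b′ c′ → R Mᵢ x b′ c′ × Zⱼ b b′ × Zᵢ c′ c
    atom-clause : ∀ {x y} → Zᵢ x y →
                  ∀ p → Mᵢ , x ⊩ var p → Mⱼ , y ⊩ var p

record IsRelevantDirectedBisimulation
         {PROP} (M₁ M₂ : Model PROP)
         (Z₁ : W M₁ → W M₂ → Set) (Z₂ : W M₂ → W M₁ → Set) : Set where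
  field
    nonempty₁ : ∃₂ Z₁
    nonempty₂ : ∃₂ Z₂
    directed₁ : Directed M₁ M₂ Z₁ Z₂
    directed₂ : Directed M₂ M₁ Z₂ Z₁

ExplicitlyDefinable : ∀ {PROP m} → (Model (Maybe PROP) → Set) →
                      Formula (Maybe PROP) m → Set₁
ExplicitlyDefinable {PROP} K φ =
  Σ (Formula PROP 1) λ θ → Relevant θ × Consequence K φ (embed θ ≡ᶠ Px)

-- Bisimulations relate models, so the points w₁ and w₂ carry no condition.
BisimulationsRespectP : ∀ {PROP m} → (Model (Maybe PROP) → Set) →
                        Formula (Maybe PROP) m → Set₁
BisimulationsRespectP {PROP} K φ =
  (M₁ M₂ : Model PROP) (w₁ : W M₁) (w₂ : W M₂)
  (P₁ : W M₁ → Set) (P₂ : W M₂ → Set) →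
  K (expand M₁ P₁) → expand M₁ P₁ ⊨ φ →
  K (expand M₂ P₂) → expand M₂ P₂ ⊨ φ →
  (Z₁ : W M₁ → W M₂ → Set) (Z₂ : W M₂ → W M₁ → Set) →
  IsRelevantDirectedBisimulation M₁ M₂ Z₁ Z₂ →
  IsRelevantDirectedBisimulation (expand M₁ P₁) (expand M₂ P₂) Z₁ Z₂

{-# OPTIONS --safe #-}

-- From explicit to implicit: relevant formulas are preserved by directed
-- bisimulations.  For the converse, suppose P is not relevantly definable.
-- Formulas of bounded depth form a set up to equivalence, so for every ordinal β
-- there are two structures in the class and points x ∈ P, y ∉ P such that y
-- simulates x up to depth β.  Expand such pairs by Skolem functions and by a
-- finite descending sequence β₀ > β₁ > … of depths, with functions choosing the
-- answers to back moves at depth βₖ that remain good at depth βₖ₊₁.  The closed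
-- Skolem terms admit only a set of atomic diagrams, against a proper class of
-- ordinals, so by pigeonhole the descending sequences can be prolonged step by
-- step without changing the diagram already fixed.  The terms modulo the limit
-- diagram yield two structures of the class, and the union over k of the depth-βₖ
-- similarities is a directed bisimulation between them that does not respect P.

module Submission where

open import Defs
open import Axiom.ExcludedMiddle using (ExcludedMiddle)
open import Axiom.Extensionality.Propositional using (Extensionality)
open import Axiom.UniquenessOfIdentityProofs using (module Decidable⇒UIP)
open import Data.Bool.Base using (Bool; true; false)
open import Data.Empty using (⊥; ⊥-elim)
open import Data.Fin.Base using (Fin; zero; suc)
open import Data.Maybe.Base using (Maybe; just; nothing)
open import Data.Nat.Base using (ℕ; zero; suc; _⊔_; _≤_; _<_; z≤n; s≤s)
open import Data.Nat.Properties using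
  (≤-refl; ≤-trans; ≤-reflexive; n≤1+n; m≤n⇒m<n∨m≡n; m≤m⊔n; m≤n⊔m; ⊔-comm; ⊔-lub; ⊔-mono-≤)
  renaming (m⊔n≤o⇒m≤o to ⊔-≤ˡ; m⊔n≤o⇒n≤o to ⊔-≤ʳ)
open import Data.Product.Base using (Σ; _×_; _,_; proj₁; proj₂; ∃; ∃₂)
open import Data.Sum.Base using (_⊎_; inj₁; inj₂)
open import Data.Unit.Base using (⊤; tt)
open import Data.Vec.Base using (Vec; []; _∷_; lookup; map; allFin)
open import Data.Vec.Properties using (lookup-map; map-∘; map-cong; map-id; map-lookup-allFin)
open import Function.Base using (_∘_; id)
open import Function.Bundles using (_⇔_; mk⇔; Equivalence)
open import Relation.Binary.PropositionalEquality hiding ([_])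
open import Relation.Nullary using (¬_; yes; no; does)
open Equivalence using (to; from)

-- Ordinals and similarity of bounded depth

reduct : ∀ {PROP} → Model (Maybe PROP) → Model PROP
reduct N = record
  { W = W N ; R = R N ; star = star N ; T = T N ; V = λ q → V N (just q) }

-- Well-founded trees stand for ordinals. They live in `Set₁` and have suprema of all set-indexed
-- families.
data Ord : Set₁ where
  node : {I : Set} → (I → Ord) → Ord

Branch : Ord → Set
Branch (node {I} _) = I

child : ∀ α → Branch α → Ord
child (node f) = f

zeroOrd : Ord
zeroOrd = node {I = ⊥} λ ()

osuc : Ord → Ord
osuc α = node {I = ⊤} λ _ → α

-- Flattening (instead of a node above the family) makes Sim (sup α) imply
-- every Sim (α i).
sup : {I : Set} → (I → Ord) → Ord
sup {I} α = node {I = Σ I λ i → Branch (α i)} λ (i , b) → child (α i) b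

Step : ∀ {PROP} (M N : Model PROP) → (W M → W N → Set) → (W N → W M → Set) →
       W M → W N → Set
Step M N Z Z′ x y =
  Z′ (star N y) (star M x) ×
  (∀ {b c} → R N y b c → ∃₂ λ b′ c′ → R M x b′ c′ × Z′ b b′ × Z c′ c)

-- The approximation at depth α of a directed bisimulation. Exchanging `M` and `N` gives the partner
-- relation, so one recursion defines both.
Sim : ∀ {PROP} → Ord → (M N : Model PROP) → W M → W N → Set
Sim (node f) M N x y =
  (∀ p → V M p x → V N p y) × (∀ i → Step M N (Sim (f i) M N) (Sim (f i) N M) x y)

Sim-atom : ∀ {PROP} α (M N : Model PROP) {x y} → Sim α M N x y →
           ∀ p → V M p x → V N p y
Sim-atom (node _) _ _ = proj₁

Sim-intro : ∀ {PROP} α (M N : Model PROP) {x y} → (∀ p → V M p x → V N p y) →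
            (∀ i → Step M N (Sim (child α i) M N) (Sim (child α i) N M) x y) →
            Sim α M N x y
Sim-intro (node _) _ _ = _,_

Sim-sup : ∀ {PROP} {I : Set} (α : I → Ord) i (M N : Model PROP) {x y} →
          Sim (sup α) M N x y → Sim (α i) M N x y
Sim-sup α i M N (atoms , steps) = Sim-intro (α i) M N atoms λ b → steps (i , b)

private variable
  Q : Set
  F : ℕ → Set
  i j : Bool
  k m n : ℕ

-- Semantics of terms

⟦subᵗ⟧ : (M : Model Q) (σ : Vec (Term n) m) (t : Term m) (ρ : Vec (W M) n) →
         ⟦ subᵗ σ t ⟧ M ρ ≡ ⟦ t ⟧ M (map (λ u → ⟦ u ⟧ M ρ) σ)
⟦subᵗ⟧ M σ (var x) ρ = sym (lookup-map x _ σ)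
⟦subᵗ⟧ M σ const   ρ = refl
⟦subᵗ⟧ M σ (t ⋆)   ρ = cong (star M) (⟦subᵗ⟧ M σ t ρ)

⟦lift⟧ : (M : Model Q) (σ : Vec (Term n) m) (w : W M) (ρ : Vec (W M) n) →
         map (λ u → ⟦ u ⟧ M (w ∷ ρ)) (lift σ) ≡ w ∷ map (λ u → ⟦ u ⟧ M ρ) σ
⟦lift⟧ M σ w ρ = cong (w ∷_) (trans (sym (map-∘ _ _ σ)) (map-cong weaken σ))
  where
  weaken : ∀ t → ⟦ subᵗ (map (λ x → var (suc x)) (allFin _)) t ⟧ M (w ∷ ρ) ≡ ⟦ t ⟧ M ρ
  weaken t = trans (⟦subᵗ⟧ M _ t (w ∷ ρ))
    (cong (⟦ t ⟧ M) (trans (sym (map-∘ _ _ (allFin _))) (map-lookup-allFin ρ)))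

⟦reduct⟧ : (N : Model (Maybe Q)) (t : Term n) (ρ : Vec (W N) n) →
           ⟦ t ⟧ N ρ ≡ ⟦ t ⟧ (reduct N) ρ
⟦reduct⟧ N (var x) ρ = refl
⟦reduct⟧ N const   ρ = refl
⟦reduct⟧ N (t ⋆)   ρ = cong (star N) (⟦reduct⟧ N t ρ)

-- Skolem terms, atomic facts and their levels

-- The quantifier occurrences of a formula in the scope of k variables: they serve
-- as its k-ary Skolem symbols.
Binder : Formula Q n → ℕ → Set
Binder (pred _ _)  k = ⊥
Binder (rel _ _ _) k = ⊥
Binder (_ ≈ _)     k = ⊥
Binder (neg φ)     k = Binder φ k
Binder (φ ⊃ ψ)     k = Binder φ k ⊎ Binder ψ k
Binder (⋀ φ)       k = ∃ λ x → Binder (φ x) k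
Binder (⋁ φ)       k = ∃ λ x → Binder (φ x) k
Binder {n = n} (all φ) k = n ≡ k ⊎ Binder φ k
Binder {n = n} (ex φ)  k = n ≡ k ⊎ Binder φ k

infix 30 _⋆

-- back₁ k t u v and back₂ k t u v denote the worlds answering the back move from
-- a world similar to t at depth ords k along R to u and v.
data Tm (F : ℕ → Set) : Bool → Set where
  point  : Tm F i
  base   : Tm F i
  _⋆     : Tm F i → Tm F i
  skolem : F k → Vec (Tm F i) k → Tm F i
  back₁ back₂ : ℕ → Tm F i → Tm F j → Tm F j → Tm F i

-- Bounds the indices of the depths that a value depends on. A back term with index `k` reads entry
-- `suc k`, the depth that its answers must keep.
lvl  : Tm F i → ℕ
lvls : Vec (Tm F i) n → ℕ
lvl point           = 0
lvl base            = 0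
lvl (t ⋆)           = lvl t
lvl (skolem _ ts)   = lvls ts
lvl (back₁ k t u v) = suc k ⊔ (lvl t ⊔ (lvl u ⊔ lvl v))
lvl (back₂ k t u v) = suc k ⊔ (lvl t ⊔ (lvl u ⊔ lvl v))
lvls []             = 0
lvls (t ∷ ts)       = lvl t ⊔ lvls ts

data Fact (Q : Set) (F : ℕ → Set) : Set where
  eq : Tm F i → Tm F i → Fact Q F
  pr : Q → Tm F i → Fact Q F
  rl : Tm F i → Tm F i → Tm F i → Fact Q F
  zz : ℕ → Tm F i → Tm F j → Fact Q F

level : Fact Q F → ℕ
level (eq t u)   = lvl t ⊔ lvl u
level (pr _ t)   = lvl t
level (rl t u v) = lvl t ⊔ (lvl u ⊔ lvl v)
level (zz k t u) = k ⊔ (lvl t ⊔ lvl u)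

inst : Term n → Vec (Tm F i) n → Tm F i
inst (var x) ρ = lookup ρ x
inst const   ρ = base
inst (t ⋆)   ρ = inst t ρ ⋆

lvl-lookup : (ρ : Vec (Tm F i) n) (x : Fin n) → lvl (lookup ρ x) ≤ lvls ρ
lvl-lookup (t ∷ ρ) zero    = m≤m⊔n _ _
lvl-lookup (t ∷ ρ) (suc x) = ≤-trans (lvl-lookup ρ x) (m≤n⊔m (lvl t) _)

lvl-inst : (t : Term n) (ρ : Vec (Tm F i) n) → lvl (inst t ρ) ≤ lvls ρ
lvl-inst (var x) ρ = lvl-lookup ρ x
lvl-inst const   ρ = z≤n
lvl-inst (t ⋆)   ρ = lvl-inst t ρ

-- Configurations and truncation of depth sequences

record Config (Q : Set) : Set₁ where
  field
    model : Bool → Model (Maybe Q)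
    world : ∀ i → W (model i)
    ords  : ℕ → Ord

open Config

override : ℕ → (ℕ → Ord) → Ord → ℕ → Ord
override zero    α β zero    = α zero
override zero    α β (suc k) = β
override (suc n) α β zero    = α zero
override (suc n) α β (suc k) = override n (α ∘ suc) β k

override-≤ : ∀ n α β {k} → k ≤ n → override n α β k ≡ α k
override-≤ zero    α β z≤n     = refl
override-≤ (suc n) α β z≤n     = refl
override-≤ (suc n) α β (s≤s p) = override-≤ n (α ∘ suc) β p

override-suc : ∀ n α β → override n α β (suc n) ≡ β
override-suc zero    α β = refl
override-suc (suc n) α β = override-suc n (α ∘ suc) β

truncate : ℕ → Config Q → Ord → Config Q
truncate n C β = record
  { model = model C ; world = world C ; ords = override n (ords C) β }

-- Classical choice and Skolem functions

module Classical (em : ∀ {ℓ} → ExcludedMiddle ℓ)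
                 (ext : ∀ {a b} → Extensionality a b) where

  -- Excluded middle ranges over all types, not only propositions, so eliminating a
  -- double negation also chooses an element.
  by-contradiction : ∀ {ℓ} {A : Set ℓ} → ¬ ¬ A → A
  by-contradiction {A = A} h with em {P = A}
  ... | yes a = a
  ... | no ¬a = ⊥-elim (h ¬a)

  -- The default makes the choice total, so that Skolem symbols and back terms denote in every
  -- structure.
  pick : {A : Set} → (A → Set) → A → A
  pick P d with em {P = ∃ P}
  ... | yes (a , _) = a
  ... | no _        = d

  pick-spec : {A : Set} (P : A → Set) (d : A) → ∃ P → P (pick P d)
  pick-spec P d e with em {P = ∃ P}
  ... | yes (_ , p) = p
  ... | no ¬e       = ⊥-elim (¬e e)

  -- At `all` the value is a counterexample if there is one, so a universal formula holds once it
  -- holds there.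
  witness : (φ : Formula Q n) (M : Model Q) → Binder φ k → Vec (W M) k → W M
  witness (neg φ) M b               = witness φ M b
  witness (φ ⊃ ψ) M (inj₁ b)        = witness φ M b
  witness (φ ⊃ ψ) M (inj₂ b)        = witness ψ M b
  witness (⋀ φ)   M (x , b)         = witness (φ x) M b
  witness (⋁ φ)   M (x , b)         = witness (φ x) M b
  witness (all φ) M (inj₁ refl) ρ   = pick (λ w → ¬ (M ⊨ φ [ w ∷ ρ ])) (T M)
  witness (all φ) M (inj₂ b)        = witness φ M b
  witness (ex φ)  M (inj₁ refl) ρ   = pick (λ w → M ⊨ φ [ w ∷ ρ ]) (T M)
  witness (ex φ)  M (inj₂ b)        = witness φ M b

  holds? : ∀ {ℓ} → Set ℓ → Bool
  holds? A = does (em {P = A})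

  holds?-true : ∀ {ℓ} {A : Set ℓ} → A → holds? A ≡ true
  holds?-true {A = A} a with em {P = A}
  ... | yes _ = refl
  ... | no ¬a = ⊥-elim (¬a a)

  holds?-sound : ∀ {ℓ} {A : Set ℓ} → holds? A ≡ true → A
  holds?-sound {A = A} h with em {P = A} | h
  ... | yes a | _ = a
  ... | no _  | ()

  -- Satisfaction under substitution, embedding and translation

  Π-cong : ∀ {A : Set} {B C : A → Set} → (∀ a → B a ≡ C a) →
           (∀ a → B a) ≡ (∀ a → C a)
  Π-cong h = cong (λ B → ∀ a → B a) (ext h)

  ∃-cong : ∀ {A : Set} {B C : A → Set} → (∀ a → B a ≡ C a) → ∃ B ≡ ∃ C
  ∃-cong h = cong ∃ (ext h)

  -- With an equality of types instead of an equivalence, extensionality handles quantifiers and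
  -- infinitary connectives by congruence.
  ⊨-sub : (M : Model Q) (σ : Vec (Term n) m) (φ : Formula Q m) (ρ : Vec (W M) n) →
          (M ⊨ sub σ φ [ ρ ]) ≡ (M ⊨ φ [ map (λ u → ⟦ u ⟧ M ρ) σ ])
  ⊨-sub M σ (pred q t) ρ = cong (V M q) (⟦subᵗ⟧ M σ t ρ)
  ⊨-sub M σ (rel s t u) ρ
    rewrite ⟦subᵗ⟧ M σ s ρ | ⟦subᵗ⟧ M σ t ρ | ⟦subᵗ⟧ M σ u ρ = refl
  ⊨-sub M σ (s ≈ t) ρ = cong₂ _≡_ (⟦subᵗ⟧ M σ s ρ) (⟦subᵗ⟧ M σ t ρ)
  ⊨-sub M σ (neg φ) ρ = cong ¬_ (⊨-sub M σ φ ρ)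
  ⊨-sub M σ (φ ⊃ ψ) ρ = cong₂ (λ A B → A → B) (⊨-sub M σ φ ρ) (⊨-sub M σ ψ ρ)
  ⊨-sub M σ (⋀ φ) ρ = Π-cong λ x → ⊨-sub M σ (φ x) ρ
  ⊨-sub M σ (⋁ φ) ρ = ∃-cong λ x → ⊨-sub M σ (φ x) ρ
  ⊨-sub M σ (all φ) ρ = Π-cong λ w →
    trans (⊨-sub M (lift σ) φ (w ∷ ρ)) (cong (M ⊨ φ [_]) (⟦lift⟧ M σ w ρ))
  ⊨-sub M σ (ex φ) ρ = ∃-cong λ w →
    trans (⊨-sub M (lift σ) φ (w ∷ ρ)) (cong (M ⊨ φ [_]) (⟦lift⟧ M σ w ρ))

  ⊨-embed : (N : Model (Maybe Q)) (φ : Formula Q n) (ρ : Vec (W N) n) →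
            (N ⊨ embed φ [ ρ ]) ≡ (reduct N ⊨ φ [ ρ ])
  ⊨-embed N (pred q t) ρ = cong (V N (just q)) (⟦reduct⟧ N t ρ)
  ⊨-embed N (rel s t u) ρ
    rewrite ⟦reduct⟧ N s ρ | ⟦reduct⟧ N t ρ | ⟦reduct⟧ N u ρ = refl
  ⊨-embed N (s ≈ t) ρ = cong₂ _≡_ (⟦reduct⟧ N s ρ) (⟦reduct⟧ N t ρ)
  ⊨-embed N (neg φ) ρ = cong ¬_ (⊨-embed N φ ρ)
  ⊨-embed N (φ ⊃ ψ) ρ = cong₂ (λ A B → A → B) (⊨-embed N φ ρ) (⊨-embed N ψ ρ)
  ⊨-embed N (⋀ φ) ρ = Π-cong λ x → ⊨-embed N (φ x) ρ
  ⊨-embed N (⋁ φ) ρ = ∃-cong λ x → ⊨-embed N (φ x) ρ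
  ⊨-embed N (all φ) ρ = Π-cong λ w → ⊨-embed N φ (w ∷ ρ)
  ⊨-embed N (ex φ) ρ = ∃-cong λ w → ⊨-embed N φ (w ∷ ρ)

  -- Mutual with `Tₓ-subst`, since negation and implication contain substituted translations, which
  -- `⊨-sub` evaluates at the value of the term.
  Tₓ-correct : (M : Model Q) (χ : RFormula Q) {w : W M} →
               (M ⊨ Tₓ χ [ w ∷ [] ]) ⇔ (M , w ⊩ χ)
  Tₓ-subst : (M : Model Q) (χ : RFormula Q) (t : Term n) {ρ : Vec (W M) n} →
             (M ⊨ Tₓ χ ⟨ t ⟩ [ ρ ]) ⇔ (M , ⟦ t ⟧ M ρ ⊩ χ)
  Tₓ-correct M (var q) = mk⇔ id id
  Tₓ-correct M bot = mk⇔ (λ h → h true (h false)) ⊥-elim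
  Tₓ-correct M (∼ χ) =
    mk⇔ (λ h s → h (from IH s)) (λ h s → h (to IH s))
    where IH = Tₓ-subst M χ (var zero ⋆)
  Tₓ-correct M (⋀ χ) =
    mk⇔ (λ h x → to (Tₓ-correct M (χ x)) (h x))
        (λ h x → from (Tₓ-correct M (χ x)) (h x))
  Tₓ-correct M (⋁ χ) =
    mk⇔ (λ (x , h) → x , to (Tₓ-correct M (χ x)) h)
        (λ (x , h) → x , from (Tₓ-correct M (χ x)) h)
  Tₓ-correct M (χ ⇒ ξ) =
    mk⇔ (λ h a b r s → to (Tₓ-subst M ξ (var zero)) (h a b λ
           { true → r ; false → from (Tₓ-subst M χ (var (suc zero))) s }))
        (λ h a b s → from (Tₓ-subst M ξ (var zero))
           (h a b (s true) (to (Tₓ-subst M χ (var (suc zero))) (s false))))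
  Tₓ-subst M χ t {ρ} =
    mk⇔ (λ h → to (Tₓ-correct M χ) (subst id (⊨-sub M (t ∷ []) (Tₓ χ) ρ) h))
        (λ h → subst id (sym (⊨-sub M (t ∷ []) (Tₓ χ) ρ)) (from (Tₓ-correct M χ) h))

  embed-Tₓ : (N : Model (Maybe Q)) (χ : RFormula Q) {w : W N} →
             (N ⊨ embed (Tₓ χ) [ w ∷ [] ]) ⇔ (reduct N , w ⊩ χ)
  embed-Tₓ N χ {w} =
    mk⇔ (λ h → to (Tₓ-correct (reduct N) χ) (subst id (⊨-embed N (Tₓ χ) _) h))
        (λ h → subst id (sym (⊨-embed N (Tₓ χ) _)) (from (Tₓ-correct (reduct N) χ) h))

  -- Preservation, and the implication from definability

  module _ {M₁ M₂ : Model Q} {Z₁ : W M₁ → W M₂ → Set} {Z₂ : W M₂ → W M₁ → Set} where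
    open Directed

    -- Both directions go together because negations and antecedents of implications swap `Z₁` and
    -- `Z₂`.
    ⊩-preserved : Directed M₁ M₂ Z₁ Z₂ → Directed M₂ M₁ Z₂ Z₁ → (χ : RFormula Q) →
                  (∀ {x y} → Z₁ x y → M₁ , x ⊩ χ → M₂ , y ⊩ χ) ×
                  (∀ {x y} → Z₂ x y → M₂ , x ⊩ χ → M₁ , y ⊩ χ)
    ⊩-preserved d₁ d₂ (var q) = (λ z → atom-clause d₁ z q) , (λ z → atom-clause d₂ z q)
    ⊩-preserved d₁ d₂ bot = (λ _ ()) , (λ _ ())
    ⊩-preserved d₁ d₂ (∼ χ) =
      (λ z h s → h (proj₂ IH (star-clause d₁ z) s)) ,
      (λ z h s → h (proj₁ IH (star-clause d₂ z) s))
      where IH = ⊩-preserved d₁ d₂ χ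
    ⊩-preserved d₁ d₂ (⋀ χ) =
      (λ z h x → proj₁ (⊩-preserved d₁ d₂ (χ x)) z (h x)) ,
      (λ z h x → proj₂ (⊩-preserved d₁ d₂ (χ x)) z (h x))
    ⊩-preserved d₁ d₂ (⋁ χ) =
      (λ z (x , h) → x , proj₁ (⊩-preserved d₁ d₂ (χ x)) z h) ,
      (λ z (x , h) → x , proj₂ (⊩-preserved d₁ d₂ (χ x)) z h)
    ⊩-preserved d₁ d₂ (χ ⇒ ξ) =
      (λ z h b c r s → let b′ , c′ , r′ , zb , zc = back-clause d₁ z r in
         proj₁ IHξ zc (h b′ c′ r′ (proj₂ IHχ zb s))) ,
      (λ z h b c r s → let b′ , c′ , r′ , zb , zc = back-clause d₂ z r in
         proj₂ IHξ zc (h b′ c′ r′ (proj₁ IHχ zb s)))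
      where
      IHχ = ⊩-preserved d₁ d₂ χ
      IHξ = ⊩-preserved d₁ d₂ ξ

  definable⇒respects : (φ : Formula (Maybe Q) m) (ψ : Formula (Maybe Q) n) →
    ExplicitlyDefinable (Mod ψ) φ → BisimulationsRespectP (Mod ψ) φ
  definable⇒respects φ ψ (_ , (χ , refl) , cons) M₁ M₂ _ _ P₁ P₂ k₁ h₁ k₂ h₂ Z₁ Z₂ bis =
    record
      { nonempty₁ = nonempty₁
      ; nonempty₂ = nonempty₂
      ; directed₁ = record
        { star-clause = star-clause directed₁
        ; back-clause = back-clause directed₁
        ; atom-clause = λ
          { z (just q) → atom-clause directed₁ z q
          ; z nothing h → P⇐ M₂ P₂ k₂ h₂ (proj₁ preserved z (P⇒ M₁ P₁ k₁ h₁ h)) }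
        }
      ; directed₂ = record
        { star-clause = star-clause directed₂
        ; back-clause = back-clause directed₂
        ; atom-clause = λ
          { z (just q) → atom-clause directed₂ z q
          ; z nothing h → P⇐ M₁ P₁ k₁ h₁ (proj₂ preserved z (P⇒ M₂ P₂ k₂ h₂ h)) }
        }
      }
    where
    open IsRelevantDirectedBisimulation bis
    open Directed
    preserved = ⊩-preserved directed₁ directed₂ χ
    module _ (M : Model _) (P : W M → Set)
             (k : expand M P ⊨ ψ) (h : expand M P ⊨ φ) {x : W M} where
      P⇒ : P x → M , x ⊩ χ
      P⇒ p = to (embed-Tₓ (expand M P) χ) (cons (expand M P) k h (x ∷ []) false p)
      P⇐ : M , x ⊩ χ → P x
      P⇐ s = cons (expand M P) k h (x ∷ []) true (from (embed-Tₓ (expand M P) χ) s)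

  -- Formulas of bounded depth and separated pairs

  -- Codes for formulas of depth α. Boolean subsets of lower codes stand for conjunctions and
  -- disjunctions, which keeps the codes in `Set`; implications from a conjunction to a disjunction
  -- are enough to express back moves.
  Frag : Set → Ord → Set
  Frag Q (node {I} f) =
    Q ⊎ Σ I λ i → Frag Q (f i) ⊎ ((Frag Q (f i) → Bool) × (Frag Q (f i) → Bool))

  formula : ∀ α → Frag Q α → RFormula Q
  meet join : ∀ α → (Frag Q α → Bool) → RFormula Q
  formula (node f) (inj₁ p)                  = var p
  formula (node f) (inj₂ (i , inj₁ χ))       = ∼ formula (f i) χ
  formula (node f) (inj₂ (i , inj₂ (S , U))) = meet (f i) S ⇒ join (f i) U
  meet α S = ⋀ {I = ∃ λ χ → S χ ≡ true} λ (χ , _) → formula α χ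
  join α U = ⋁ {I = ∃ λ χ → U χ ≡ true} λ (χ , _) → formula α χ

  preserves⇒Sim : ∀ α (M N : Model Q) {x y} →
    (∀ χ → M , x ⊩ formula α χ → N , y ⊩ formula α χ) → Sim α M N x y
  preserves⇒Sim (node f) M N {x} {y} pres = (λ p → pres (inj₁ p)) , λ i →
    preserves⇒Sim (f i) N M (λ χ s → by-contradiction λ ¬s →
      pres (inj₂ (i , inj₁ χ)) ¬s s) ,
    λ {b} {c} r → by-contradiction λ none →
      -- `S` is the theory of `b` and `U` the formulas false at `c`, both at the lower depth. By
      -- induction an unanswered move makes `meet S ⇒ join U` true at `x`, hence at `y`, so some
      -- formula of `U` holds at `c`.
      let S : Frag _ (f i) → Bool
          S χ = holds? (N , b ⊩ formula (f i) χ)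
          U : Frag _ (f i) → Bool
          U χ = holds? (¬ (N , c ⊩ formula (f i) χ))
          x⊩ : M , x ⊩ meet (f i) S ⇒ join (f i) U
          x⊩ b′ c′ r′ s = by-contradiction λ ¬u → none (b′ , c′ , r′ ,
            preserves⇒Sim (f i) N M (λ χ t → s (χ , holds?-true t)) ,
            preserves⇒Sim (f i) M N (λ χ t → by-contradiction λ ¬t →
              ¬u ((χ , holds?-true ¬t) , t)))
          (χ , Uχ) , c⊩χ = pres (inj₂ (i , inj₂ (S , U))) x⊩ b c r
                             (λ (χ , Sχ) → holds?-sound Sχ)
      in holds?-sound Uχ c⊩χ

  Separated : (φ : Formula (Maybe Q) m) (ψ : Formula (Maybe Q) n) → Ord → Set₁
  Separated {Q} φ ψ α =
    Σ (Model (Maybe Q)) λ N₁ → Σ (Model (Maybe Q)) λ N₂ →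
    (N₁ ⊨ ψ × N₁ ⊨ φ) × (N₂ ⊨ ψ × N₂ ⊨ φ) × ∃₂ λ x y →
    V N₁ nothing x × ¬ V N₂ nothing y × Sim α (reduct N₁) (reduct N₂) x y

  -- Without separated pairs at depth α, a point of a structure in the class is in P as soon as it
  -- satisfies the depth-α theory of some point of P. The disjunction of these theories then defines
  -- P.
  undefinable⇒separated : (φ : Formula (Maybe Q) m) (ψ : Formula (Maybe Q) n) →
    ¬ ExplicitlyDefinable (Mod ψ) φ → ∀ α → Separated φ ψ α
  undefinable⇒separated {Q} φ ψ undef α = by-contradiction λ inseparable →
    undef (Tₓ θ , (θ , refl) , λ N k h → λ
      { (y ∷ []) true s → by-contradiction λ ¬Py →
          let (S , real) , y⊩S = to (embed-Tₓ N θ) s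
              N₁ , K₁ , x , Px , x⊆S = holds?-sound real
          in inseparable (N₁ , N , K₁ , (k , h) , x , y , Px , ¬Py ,
               preserves⇒Sim α (reduct N₁) (reduct N) λ χ t → y⊩S (χ , x⊆S χ t))
      ; (x ∷ []) false Px → from (embed-Tₓ N θ)
          (((λ χ → holds? (reduct N , x ⊩ formula α χ)) ,
            holds?-true (N , (k , h) , x , Px , λ χ → holds?-true)) ,
           λ (χ , Sχ) → holds?-sound Sχ) })
    where
    Realized : (Frag Q α → Bool) → Set₁
    Realized S = Σ (Model (Maybe Q)) λ N → (N ⊨ ψ × N ⊨ φ) × ∃ λ x →
      V N nothing x × (∀ χ → reduct N , x ⊩ formula α χ → S χ ≡ true)
    -- `Realized S` is a large type; taking its Boolean value keeps the index type of the
    -- disjunction small.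
    θ : RFormula Q
    θ = ⋁ {I = ∃ λ S → holds? (Realized S) ≡ true} λ (S , _) → meet α S

  -- Depths are compared by the similarity they enforce, which spares an order on trees.
  _⊒_ : Ord → Ord → Set → Set₁
  (α ⊒ β) Q = ∀ (M N : Model Q) {x y} → Sim α M N x y → Sim β M N x y

  -- Evaluation of terms and facts in a configuration

  module Limit {Q : Set} {F : ℕ → Set}
               (I : ∀ (M : Model (Maybe Q)) {k} → F k → Vec (W M) k → W M) where

    rd : Config Q → Bool → Model Q
    rd C i = reduct (model C i)

    Response : (M N : Model (Maybe Q)) → Ord → W M → (b c : W N) → W M × W M → Set
    Response M N α x b c (b′ , c′) =
      R M x b′ c′ × Sim α (reduct N) (reduct M) b b′ × Sim α (reduct M) (reduct N) c′ c

    response : (M N : Model (Maybe Q)) → Ord → W M → (b c : W N) → W M × W M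
    response M N α x b c = pick (Response M N α x b c) (T M , T M)

    respond : ∀ (C : Config Q) → ℕ → W (model C i) → (b c : W (model C j)) →
              W (model C i) × W (model C i)
    respond C k = response (model C _) (model C _) (ords C (suc k))

    ev  : ∀ (C : Config Q) → Tm F i → W (model C i)
    evs : ∀ (C : Config Q) → Vec (Tm F i) n → Vec (W (model C i)) n
    ev C point           = world C _
    ev C base            = T (model C _)
    ev C (t ⋆)           = star (model C _) (ev C t)
    ev C (skolem f ts)   = I (model C _) f (evs C ts)
    ev C (back₁ k t u v) = proj₁ (respond C k (ev C t) (ev C u) (ev C v))
    ev C (back₂ k t u v) = proj₂ (respond C k (ev C t) (ev C u) (ev C v))
    evs C []             = []
    evs C (t ∷ ts)       = ev C t ∷ evs C ts

    Holds : Config Q → Fact (Maybe Q) F → Set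
    Holds C (eq t u)       = ev C t ≡ ev C u
    Holds C (pr q t)       = V (model C _) q (ev C t)
    Holds C (rl t u v)     = R (model C _) (ev C t) (ev C u) (ev C v)
    Holds C (zz {i} {j} k t u) = Sim (ords C k) (rd C i) (rd C j) (ev C t) (ev C u)

    truth : Config Q → Fact (Maybe Q) F → Bool
    truth C f = holds? (Holds C f)

    -- Stability under truncation

    module _ (C : Config Q) (n : ℕ) (β : Ord) where
      private C′ = truncate n C β

      -- A term of level at most `n` consults only depth entries up to `n`, which truncation keeps.
      ev-truncate  : (t : Tm F i) → lvl t ≤ n → ev C′ t ≡ ev C t
      evs-truncate : (ts : Vec (Tm F i) m) → lvls ts ≤ n → evs C′ ts ≡ evs C ts
      back-truncate : ∀ k (t : Tm F i) (u v : Tm F j) →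
                      suc k ⊔ (lvl t ⊔ (lvl u ⊔ lvl v)) ≤ n →
                      respond C′ k (ev C′ t) (ev C′ u) (ev C′ v) ≡
                      respond C k (ev C t) (ev C u) (ev C v)
      ev-truncate point le = refl
      ev-truncate base le = refl
      ev-truncate (t ⋆) le = cong (star (model C _)) (ev-truncate t le)
      ev-truncate (skolem f ts) le = cong (I (model C _) f) (evs-truncate ts le)
      ev-truncate (back₁ k t u v) le = cong proj₁ (back-truncate k t u v le)
      ev-truncate (back₂ k t u v) le = cong proj₂ (back-truncate k t u v le)
      evs-truncate [] le = refl
      evs-truncate (t ∷ ts) le =
        cong₂ _∷_ (ev-truncate t (⊔-≤ˡ _ (lvls ts) le)) (evs-truncate ts (⊔-≤ʳ (lvl t) _ le))
      back-truncate k t u v le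
        rewrite ev-truncate t (⊔-≤ˡ _ _ (⊔-≤ʳ (suc k) _ le))
              | ev-truncate u (⊔-≤ˡ _ _ (⊔-≤ʳ (lvl t) _ (⊔-≤ʳ (suc k) _ le)))
              | ev-truncate v (⊔-≤ʳ (lvl u) _ (⊔-≤ʳ (lvl t) _ (⊔-≤ʳ (suc k) _ le)))
        = cong (λ α → response (model C _) (model C _) α (ev C t) (ev C u) (ev C v))
               (override-≤ n (ords C) β (⊔-≤ˡ (suc k) (lvl t ⊔ (lvl u ⊔ lvl v)) le))

      Holds-truncate : ∀ f → level f ≤ n → Holds C′ f ≡ Holds C f
      Holds-truncate (eq t u) le =
        cong₂ _≡_ (ev-truncate t (⊔-≤ˡ _ _ le)) (ev-truncate u (⊔-≤ʳ (lvl t) _ le))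
      Holds-truncate (pr q t) le = cong (V (model C _) q) (ev-truncate t le)
      Holds-truncate (rl t u v) le
        rewrite ev-truncate t (⊔-≤ˡ _ _ le)
              | ev-truncate u (⊔-≤ˡ _ _ (⊔-≤ʳ (lvl t) _ le))
              | ev-truncate v (⊔-≤ʳ (lvl u) _ (⊔-≤ʳ (lvl t) _ le)) = refl
      Holds-truncate (zz k t u) le
        rewrite ev-truncate t (⊔-≤ˡ _ _ (⊔-≤ʳ k _ le))
              | ev-truncate u (⊔-≤ʳ (lvl t) _ (⊔-≤ʳ k _ le))
              | override-≤ n (ords C) β (⊔-≤ˡ k _ le) = refl

    -- Prolonging the descending sequences

    module Stages (K : Model (Maybe Q) → Set) where

      -- Entries up to `n` are the depths fixed so far; `covers` keeps β in reserve below them.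
      record Good (n : ℕ) (β : Ord) (C : Config Q) : Set₁ where
        field
          in-class : ∀ i → K (model C i)
          inside   : V (model C true) nothing (world C true)
          outside  : ¬ V (model C false) nothing (world C false)
          similar  : Sim (ords C 0) (rd C true) (rd C false) (world C true) (world C false)
          descends : ∀ k → k < n → (ords C k ⊒ osuc (ords C (suc k))) Q
          covers   : (ords C n ⊒ β) Q

      open Good

      -- A single pattern serves every β; this unlimited reserve is what lets the sequence be
      -- prolonged.
      Stage : ℕ → (Fact (Maybe Q) F → Bool) → Set₁
      Stage n p = ∀ β → Σ (Config Q) λ C → Good n β C × (∀ f → truth C f ≡ p f)

      -- There is only a set of truth patterns but a proper class of ordinals.
      pigeonhole : (X : Ord → Config Q → Set₁) →
        (∀ {J : Set} (β : J → Ord) i C → X (sup β) C → X (β i) C) →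
        (∀ β → Σ (Config Q) (X β)) →
        ∃ λ p → ∀ β → Σ (Config Q) λ C → X β C × (∀ f → truth C f ≡ p f)
      pigeonhole X mono all-β = by-contradiction λ none →
        let bad : ∀ p → Σ Ord λ β → ∀ C → X β C → ¬ (∀ f → truth C f ≡ p f)
            bad p = by-contradiction λ nb → none (p , λ β → by-contradiction λ nc →
                      nb (β , λ C x t → nc (C , x , t)))
            -- The configuration found at the supremum of the bad ordinals has a pattern of its own,
            -- and contradicts the ordinal chosen for that pattern.
            C , x = all-β (sup λ p → proj₁ (bad p))
        in proj₂ (bad (truth C)) C (mono (λ p → proj₁ (bad p)) (truth C) C x) λ _ → refl

      Good-sup : ∀ {J : Set} (β : J → Ord) i C → Good n (sup β) C → Good n (β i) C
      Good-sup β i C g = record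
        { in-class = in-class g
        ; inside = inside g
        ; outside = outside g
        ; similar = similar g
        ; descends = descends g
        ; covers = λ M N s → Sim-sup β i M N (covers g M N s)
        }

      -- A reserve of `osuc β` pays for one more entry, set to β, which is also the reserve left.
      Good-truncate : ∀ {n β} C → Good n (osuc β) C → Good (suc n) β (truncate n C β)
      Good-truncate {n} {β} C g = record
        { in-class = in-class g
        ; inside = inside g
        ; outside = outside g
        ; similar = subst
            (λ α → Sim α (rd C true) (rd C false) (world C true) (world C false))
            (sym (override-≤ n (ords C) β z≤n)) (similar g)
        ; descends = desc
        ; covers = λ M N → subst (λ α → Sim α M N _ _) (override-suc n (ords C) β)
        }
        where
        desc : ∀ k → k < suc n →
          (override n (ords C) β k ⊒ osuc (override n (ords C) β (suc k))) Q
        desc k (s≤s k≤n) with m≤n⇒m<n∨m≡n k≤n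
        ... | inj₁ k<n rewrite override-≤ n (ords C) β k≤n
                             | override-≤ n (ords C) β k<n = descends g k k<n
        -- The descent from entry `n` to the new entry is the old `covers`.
        ... | inj₂ refl rewrite override-≤ n (ords C) β k≤n
                              | override-suc n (ords C) β = covers g

      module _ (start : ∀ β → Σ (Config Q) (Good 0 β)) where

        step : ∀ {n p} → Stage n p →
               ∃ λ p′ → Stage (suc n) p′ × (∀ f → level f ≤ n → p′ f ≡ p f)
        step {n} {p} stage = p′ , (λ β → let C , (g , _) , t = next β in C , g , t) ,
          -- Both patterns are independent of β, so one configuration suffices to compare them.
          λ f le → let C , (_ , a) , t = next zeroOrd in
                   trans (sym (t f)) (a f le)
          where
          X : Ord → Config Q → Set₁
          X β C = Good (suc n) β C × (∀ f → level f ≤ n → truth C f ≡ p f)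
          result = pigeonhole X (λ β i C (g , a) → Good-sup β i C g , a) λ β →
            let C , g , t = stage (osuc β) in
            truncate n C β , Good-truncate C g , λ f le →
              trans (cong (λ A → holds? A) (Holds-truncate C n β f le)) (t f)
          p′ = proj₁ result
          next = proj₂ result

        stages : ∀ n → ∃ (Stage n)
        stages zero    = pigeonhole (Good 0) Good-sup start
        stages (suc n) = let p , stage , _ = step (proj₂ (stages n)) in p , stage

        pattern-at : ℕ → Fact (Maybe Q) F → Bool
        pattern-at n = proj₁ (stages n)

        pattern-suc : ∀ n f → level f ≤ n → pattern-at (suc n) f ≡ pattern-at n f
        pattern-suc n = proj₂ (proj₂ (step (proj₂ (stages n))))

        p∞ : Fact (Maybe Q) F → Bool
        p∞ f = pattern-at (level f) f

        pattern-stable : ∀ n f → level f ≤ n → pattern-at n f ≡ p∞ f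
        pattern-stable n f le with m≤n⇒m<n∨m≡n le
        pattern-stable (suc n) f _ | inj₁ (s≤s le) =
          trans (pattern-suc n f le) (pattern-stable n f le)
        pattern-stable n f _ | inj₂ l≡n = cong (λ l → pattern-at l f) (sym l≡n)

        -- Configurations of different stages may come from different structures; only the limit
        -- pattern ties them together.
        coherent : Σ (ℕ → Config Q) λ C → Σ (Fact (Maybe Q) F → Bool) λ p →
                   (∀ n → Good n zeroOrd (C n)) ×
                   (∀ n (f : Fact (Maybe Q) F) → level f ≤ n → truth (C n) f ≡ p f)
        coherent = (λ n → proj₁ (at n)) , p∞ , (λ n → proj₁ (proj₂ (at n))) ,
          λ n f le → trans (proj₂ (proj₂ (at n)) f) (pattern-stable n f le)
          where
          at : ∀ n → Σ (Config Q) λ C → Good n zeroOrd C × (∀ f → truth C f ≡ pattern-at n f)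
          at n = proj₂ (stages n) zeroOrd

    -- The term model of the limit pattern

    module TermModel (C : ℕ → Config Q) (p∞ : Fact (Maybe Q) F → Bool)
                     (truth-C : ∀ n f → level f ≤ n → truth (C n) f ≡ p∞ f) where

      to-p∞ : ∀ n f → level f ≤ n → Holds (C n) f → p∞ f ≡ true
      to-p∞ n f le h = trans (sym (truth-C n f le)) (holds?-true h)

      from-p∞ : ∀ n f → level f ≤ n → p∞ f ≡ true → Holds (C n) f
      from-p∞ n f le h = holds?-sound (trans (truth-C n f le) h)

      -- Both facts are compared at one stage beyond `m` and their levels, so identities valid from
      -- some stage on pass to the limit.
      p∞-cong : ∀ m f g → (∀ n → m ≤ n → Holds (C n) f ≡ Holds (C n) g) → p∞ f ≡ p∞ g
      p∞-cong m f g h =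
        trans (sym (truth-C l f (⊔-≤ˡ _ _ le)))
          (trans (cong (λ A → holds? A) (h l (m≤m⊔n m _))) (truth-C l g (⊔-≤ʳ (level f) _ le)))
        where
        l : ℕ
        l = m ⊔ (level f ⊔ level g)
        le : level f ⊔ level g ≤ l
        le = m≤n⊔m m _

      -- The correspondence language has genuine equality, so the terms are quotiented
      -- by choosing representatives; choose depends on the class of t only.
      choose : (Tm F i → Bool) → Tm F i
      choose e = pick (λ u → e u ≡ true) base

      rep : Tm F i → Tm F i
      rep t = choose λ u → p∞ (eq t u)

      rep-eq : (t : Tm F i) → p∞ (eq t (rep t)) ≡ true
      rep-eq t = pick-spec (λ u → p∞ (eq t u) ≡ true) base
                   (t , to-p∞ (lvl t ⊔ lvl t) (eq t t) ≤-refl refl)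

      rep-cong : (t u : Tm F i) → p∞ (eq t u) ≡ true → rep t ≡ rep u
      rep-cong t u h = cong choose (ext λ v →
        p∞-cong (lvl t ⊔ lvl u) (eq t v) (eq u v) λ n le →
          cong (_≡ ev (C n) v) (from-p∞ n (eq t u) le h))

      -- A representative may have a higher level than the term it represents.
      rlvl : Tm F i → ℕ
      rlvl t = lvl t ⊔ lvl (rep t)

      ev-rep : ∀ n (t : Tm F i) → rlvl t ≤ n → ev (C n) (rep t) ≡ ev (C n) t
      ev-rep n t le = sym (from-p∞ n (eq t (rep t)) le (rep-eq t))

      rep-cong⁻¹ : (t u : Tm F i) → rep t ≡ rep u → p∞ (eq t u) ≡ true
      rep-cong⁻¹ t u h = trans
        (p∞-cong (rlvl u) (eq t u) (eq t (rep u)) λ n le →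
          cong (ev (C n) t ≡_) (sym (ev-rep n u le)))
        (subst (λ v → p∞ (eq t v) ≡ true) h (rep-eq t))

      rep-idem : (t : Tm F i) → rep (rep t) ≡ rep t
      rep-idem t = sym (rep-cong t (rep t) (rep-eq t))

      p∞-pr : ∀ q (t : Tm F i) → p∞ (pr q (rep t)) ≡ p∞ (pr q t)
      p∞-pr q t = p∞-cong (rlvl t) (pr q (rep t)) (pr q t) λ n le →
        cong (V (model (C n) _) q) (ev-rep n t le)

      p∞-rl : (t u v : Tm F i) → p∞ (rl (rep t) (rep u) (rep v)) ≡ p∞ (rl t u v)
      p∞-rl t u v = p∞-cong (rlvl t ⊔ (rlvl u ⊔ rlvl v)) (rl (rep t) (rep u) (rep v)) (rl t u v) lem
        where
        lem : ∀ n → rlvl t ⊔ (rlvl u ⊔ rlvl v) ≤ n →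
              Holds (C n) (rl (rep t) (rep u) (rep v)) ≡ Holds (C n) (rl t u v)
        lem n le rewrite ev-rep n t (⊔-≤ˡ _ _ le)
                       | ev-rep n u (⊔-≤ˡ _ _ (⊔-≤ʳ (rlvl t) _ le))
                       | ev-rep n v (⊔-≤ʳ (rlvl u) _ (⊔-≤ʳ (rlvl t) _ le)) = refl

      p∞-zz : ∀ k (t : Tm F i) (u : Tm F j) → p∞ (zz k (rep t) (rep u)) ≡ p∞ (zz k t u)
      p∞-zz k t u = p∞-cong (rlvl t ⊔ rlvl u) (zz k (rep t) (rep u)) (zz k t u) lem
        where
        lem : ∀ n → rlvl t ⊔ rlvl u ≤ n →
              Holds (C n) (zz k (rep t) (rep u)) ≡ Holds (C n) (zz k t u)
        lem n le rewrite ev-rep n t (⊔-≤ˡ _ _ le)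
                       | ev-rep n u (⊔-≤ʳ (rlvl t) _ le) = refl

      N : Bool → Model (Maybe Q)
      cls : Tm F i → ∃ λ (t : Tm F i) → rep t ≡ t
      cls t = rep t , rep-idem t
      N i = record
        { W    = ∃ λ (t : Tm F i) → rep t ≡ t
        ; R    = λ (t , _) (u , _) (v , _) → p∞ (rl t u v) ≡ true
        ; star = λ (t , _) → cls (t ⋆)
        ; T    = cls base
        ; V    = λ q (t , _) → p∞ (pr q t) ≡ true
        }

      -- Excluded middle decides equality of terms, so proofs of `rep t ≡ t` are unique.
      W-≡ : {a b : W (N i)} → proj₁ a ≡ proj₁ b → a ≡ b
      W-≡ {a = t , _} refl = cong (t ,_) (≡-irrelevant _ _)
        where open Decidable⇒UIP (λ _ _ → em) using (≡-irrelevant)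

      cls-proj₁ : (a : W (N i)) → cls (proj₁ a) ≡ a
      cls-proj₁ a = W-≡ (proj₂ a)

      cls-star : (t : Tm F i) → star (N i) (cls t) ≡ cls (t ⋆)
      cls-star t = W-≡ (rep-cong (rep t ⋆) (t ⋆)
        (to-p∞ l (eq (rep t ⋆) (t ⋆)) (≤-reflexive (⊔-comm (lvl (rep t)) (lvl t)))
          (cong (star (model (C l) _)) (ev-rep l t ≤-refl))))
        where
        l : ℕ
        l = rlvl t

      ⟦inst⟧ : (t : Term n) (ρ : Vec (Tm F i) n) → ⟦ t ⟧ (N i) (map cls ρ) ≡ cls (inst t ρ)
      ⟦inst⟧ (var x) ρ = lookup-map x cls ρ
      ⟦inst⟧ const   ρ = refl
      ⟦inst⟧ (t ⋆)   ρ = trans (cong (star (N _)) (⟦inst⟧ t ρ)) (cls-star (inst t ρ))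

      lookup-evs : (D : Config Q) (ρ : Vec (Tm F i) n) (x : Fin n) →
                   lookup (evs D ρ) x ≡ ev D (lookup ρ x)
      lookup-evs D (t ∷ ρ) zero    = refl
      lookup-evs D (t ∷ ρ) (suc x) = lookup-evs D ρ x

      ev-inst : (D : Config Q) (t : Term n) (ρ : Vec (Tm F i) n) →
                ⟦ t ⟧ (model D i) (evs D ρ) ≡ ev D (inst t ρ)
      ev-inst D (var x) ρ = lookup-evs D ρ x
      ev-inst D const   ρ = refl
      ev-inst D (t ⋆)   ρ = cong (star (model D _)) (ev-inst D t ρ)

      decide : ∀ l f → level f ≤ l → {A B : Set} → A ≡ (p∞ f ≡ true) → B ≡ Holds (C l) f →
               A ⇔ B
      decide l f le refl refl = mk⇔ (from-p∞ l f le) (to-p∞ l f le)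

      -- Restricting ρ to terms of level at most l lets the quantifier cases move
      -- between stages: Skolem terms over ρ have the same level as ρ.
      truth-lemma : (χ : Formula (Maybe Q) n) (e : ∀ {k} → Binder χ k → F k) →
        (∀ M {k} (b : Binder χ k) ρ → I M (e b) ρ ≡ witness χ M b ρ) →
        (ρ : Vec (Tm F i) n) → ∀ l → lvls ρ ≤ l →
        (N i ⊨ χ [ map cls ρ ]) ⇔ (model (C l) i ⊨ χ [ evs (C l) ρ ])
      truth-lemma (pred q t) e compat ρ l le =
        decide l (pr q (inst t ρ)) (≤-trans (lvl-inst t ρ) le)
          (trans (cong (V (N _) q) (⟦inst⟧ t ρ)) (cong (_≡ true) (p∞-pr q (inst t ρ))))
          (cong (V (model (C l) _) q) (ev-inst (C l) t ρ))
      truth-lemma {i = i} (rel s t u) e compat ρ l le =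
        decide l (rl (inst s ρ) (inst t ρ) (inst u ρ))
          (⊔-lub (≤-trans (lvl-inst s ρ) le)
            (⊔-lub (≤-trans (lvl-inst t ρ) le) (≤-trans (lvl-inst u ρ) le)))
          lhs rhs
        where
        lhs : R (N i) (⟦ s ⟧ (N i) (map cls ρ)) (⟦ t ⟧ (N i) (map cls ρ)) (⟦ u ⟧ (N i) (map cls ρ))
              ≡ (p∞ (rl (inst s ρ) (inst t ρ) (inst u ρ)) ≡ true)
        lhs rewrite ⟦inst⟧ s ρ | ⟦inst⟧ t ρ | ⟦inst⟧ u ρ =
          cong (_≡ true) (p∞-rl (inst s ρ) (inst t ρ) (inst u ρ))
        rhs : (model (C l) i ⊨ rel s t u [ evs (C l) ρ ])
              ≡ Holds (C l) (rl (inst s ρ) (inst t ρ) (inst u ρ))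
        rhs rewrite ev-inst (C l) s ρ | ev-inst (C l) t ρ | ev-inst (C l) u ρ = refl
      truth-lemma (s ≈ t) e compat ρ l le =
        mk⇔ (λ h → trans (ev-inst (C l) s ρ) (trans
               (from-p∞ l f le′ (rep-cong⁻¹ (inst s ρ) (inst t ρ)
                 (cong proj₁ (trans (sym (⟦inst⟧ s ρ)) (trans h (⟦inst⟧ t ρ))))))
               (sym (ev-inst (C l) t ρ))))
            (λ h → trans (⟦inst⟧ s ρ) (trans
               (W-≡ (rep-cong (inst s ρ) (inst t ρ) (to-p∞ l f le′
                 (trans (sym (ev-inst (C l) s ρ)) (trans h (ev-inst (C l) t ρ))))))
               (sym (⟦inst⟧ t ρ))))
        where
        f : Fact (Maybe Q) F
        f = eq (inst s ρ) (inst t ρ)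
        le′ : level f ≤ l
        le′ = ⊔-lub (≤-trans (lvl-inst s ρ) le) (≤-trans (lvl-inst t ρ) le)
      truth-lemma (neg χ) e compat ρ l le =
        mk⇔ (λ h s → h (from IH s)) (λ h s → h (to IH s))
        where IH = truth-lemma χ e compat ρ l le
      truth-lemma (χ ⊃ ξ) e compat ρ l le =
        mk⇔ (λ h s → to IHξ (h (from IHχ s))) (λ h s → from IHξ (h (to IHχ s)))
        where
        IHχ = truth-lemma χ (λ b → e (inj₁ b)) (λ M b → compat M (inj₁ b)) ρ l le
        IHξ = truth-lemma ξ (λ b → e (inj₂ b)) (λ M b → compat M (inj₂ b)) ρ l le
      truth-lemma (⋀ χ) e compat ρ l le =
        mk⇔ (λ h x → to (IH x) (h x)) (λ h x → from (IH x) (h x))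
        where
        IH = λ x → truth-lemma (χ x) (λ b → e (x , b)) (λ M b → compat M (x , b)) ρ l le
      truth-lemma (⋁ χ) e compat ρ l le =
        mk⇔ (λ (x , h) → x , to (IH x) h) (λ (x , h) → x , from (IH x) h)
        where
        IH = λ x → truth-lemma (χ x) (λ b → e (x , b)) (λ M b → compat M (x , b)) ρ l le
      truth-lemma {i = i} (all χ) e compat ρ l le = mk⇔
        -- If a world at stage `l` refuted χ, then `t₀` would denote such a world, but χ holds at
        -- `t₀` in the limit.
        (λ h w → by-contradiction λ ¬s →
           pick-spec (λ w → ¬ (model (C l) i ⊨ χ [ w ∷ evs (C l) ρ ])) (T (model (C l) i)) (w , ¬s)
             (subst (λ w → model (C l) i ⊨ χ [ w ∷ evs (C l) ρ ]) (compat _ (inj₁ refl) _)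
               (to (IH t₀ l le₀) (h (cls t₀)))))
        (λ h w → subst (λ w → N i ⊨ χ [ w ∷ map cls ρ ]) (cls-proj₁ w)
           (from (IH (proj₁ w) (lvl (proj₁ w) ⊔ l) (⊔-mono-≤ ≤-refl le)) (instance-at h (proj₁ w))))
        where
        t₀ : Tm F i
        t₀ = skolem (e (inj₁ refl)) ρ
        le₀ : lvls ρ ⊔ lvls ρ ≤ l
        le₀ = ⊔-lub le le
        IH : ∀ t l → lvl t ⊔ lvls ρ ≤ l → (N i ⊨ χ [ cls t ∷ map cls ρ ]) ⇔
             (model (C l) i ⊨ χ [ ev (C l) t ∷ evs (C l) ρ ])
        IH t = truth-lemma χ (λ b → e (inj₂ b)) (λ M b → compat M (inj₂ b)) (t ∷ ρ)
        -- The term `t` may be settled only after stage `l`. Truth at `t₀` passes through the limit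
        -- to stage `l′`, where it rules out every counterexample.
        instance-at : (∀ w → model (C l) i ⊨ χ [ w ∷ evs (C l) ρ ]) →
          ∀ t → model (C (lvl t ⊔ l)) i ⊨ χ [ ev (C (lvl t ⊔ l)) t ∷ evs (C (lvl t ⊔ l)) ρ ]
        instance-at h t = by-contradiction λ ¬s →
          pick-spec (λ w → ¬ (M′ ⊨ χ [ w ∷ evs (C l′) ρ ])) (T M′) (_ , ¬s)
            (subst (λ w → M′ ⊨ χ [ w ∷ evs (C l′) ρ ]) (compat M′ (inj₁ refl) _)
              (to (IH t₀ l′ (≤-trans le₀ (m≤n⊔m (lvl t) l)))
                (from (IH t₀ l le₀) (h _))))
          where
          l′ : ℕ
          l′ = lvl t ⊔ l
          M′ : Model (Maybe Q)
          M′ = model (C l′) i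
      truth-lemma {i = i} (ex χ) e compat ρ l le = mk⇔
        (λ (w , h) →
           let t = proj₁ w
               l′ = lvl t ⊔ l
               s : model (C l′) i ⊨ χ [ ev (C l′) t ∷ evs (C l′) ρ ]
               s = to (IH t l′ (⊔-mono-≤ ≤-refl le))
                     (subst (λ w → N i ⊨ χ [ w ∷ map cls ρ ]) (sym (cls-proj₁ w)) h)
           -- At `l′` the Skolem term replaces the witness `t`; having the level of `ρ`, it can be
           -- brought back to `l` through the limit.
           in _ , to (IH t₀ l le₀) (from (IH t₀ l′ (≤-trans le₀ (m≤n⊔m (lvl t) l)))
                    (skolemize l′ (_ , s))))
        (λ h → _ , from (IH t₀ l le₀) (skolemize l h))
        where
        t₀ : Tm F i
        t₀ = skolem (e (inj₁ refl)) ρ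
        le₀ : lvls ρ ⊔ lvls ρ ≤ l
        le₀ = ⊔-lub le le
        IH : ∀ t l → lvl t ⊔ lvls ρ ≤ l → (N i ⊨ χ [ cls t ∷ map cls ρ ]) ⇔
             (model (C l) i ⊨ χ [ ev (C l) t ∷ evs (C l) ρ ])
        IH t = truth-lemma χ (λ b → e (inj₂ b)) (λ M b → compat M (inj₂ b)) (t ∷ ρ)
        skolemize : ∀ l → (∃ λ w → model (C l) i ⊨ χ [ w ∷ evs (C l) ρ ]) →
                    model (C l) i ⊨ χ [ ev (C l) t₀ ∷ evs (C l) ρ ]
        skolemize l h =
          subst (λ w → M ⊨ χ [ w ∷ evs (C l) ρ ]) (sym (compat M (inj₁ refl) _))
            (pick-spec (λ w → M ⊨ χ [ w ∷ evs (C l) ρ ]) (T M) h)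
          where
          M : Model (Maybe Q)
          M = model (C l) i

      ⊨-limit : (χ : Formula (Maybe Q) n) (e : ∀ {k} → Binder χ k → F k) →
        (∀ M {k} (b : Binder χ k) ρ → I M (e b) ρ ≡ witness χ M b ρ) →
        (∀ l → model (C l) i ⊨ χ) → N i ⊨ χ
      ⊨-limit {i = i} χ e compat h ρ =
        subst (N i ⊨ χ [_])
          (trans (sym (map-∘ cls proj₁ ρ)) (trans (map-cong cls-proj₁ ρ) (map-id ρ)))
          (from (truth-lemma χ e compat (map proj₁ ρ) _ ≤-refl) (h _ _))

      -- The limit bisimulation

      -- Each move passes from index `k` to `suc k`. The descent is finite at every stage but has no
      -- last index in the limit, so the union over `k` is closed under moves.
      Z : ∀ i j → W (N i) → W (N j) → Set
      Z i j (t , _) (u , _) = ∃ λ k → p∞ (zz k t u) ≡ true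

      module _ (descends : ∀ n k → k < n → (ords (C n) k ⊒ osuc (ords (C n) (suc k))) Q) where

        -- Stage `l` exceeds `k`, so the descent from entry `k` to entry `suc k` is available there
        -- and buys one step.
        Z-step : ∀ k l (t : Tm F i) (u : Tm F j) → suc k ⊔ (lvl t ⊔ lvl u) ≤ l →
          p∞ (zz k t u) ≡ true →
          Step (rd (C l) i) (rd (C l) j)
            (Sim (ords (C l) (suc k)) (rd (C l) i) (rd (C l) j))
            (Sim (ords (C l) (suc k)) (rd (C l) j) (rd (C l) i)) (ev (C l) t) (ev (C l) u)
        Z-step {i = i} {j} k l t u le h = proj₂ (descends l k k<l (rd (C l) i) (rd (C l) j)
          (from-p∞ l (zz k t u) (⊔-lub (≤-trans (n≤1+n k) k<l) (⊔-≤ʳ (suc k) _ le)) h)) tt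
          where
          k<l : k < l
          k<l = ⊔-≤ˡ (suc k) (lvl t ⊔ lvl u) le

        Z-directed : ∀ i j → Directed (reduct (N i)) (reduct (N j)) (Z i j) (Z j i)
        Z-directed i j = record
          { star-clause = λ { {t , _} {u , _} (k , h) → suc k ,
              let l = suc k ⊔ (lvl t ⊔ lvl u)
                  ≤l : lvl t ⊔ lvl u ≤ l
                  ≤l = m≤n⊔m (suc k) _
              in trans (p∞-zz (suc k) (u ⋆) (t ⋆))
                (to-p∞ l (zz (suc k) (u ⋆) (t ⋆))
                  (⊔-lub (m≤m⊔n (suc k) (lvl t ⊔ lvl u))
                    (⊔-lub (⊔-≤ʳ (lvl t) _ ≤l) (⊔-≤ˡ _ (lvl u) ≤l)))
                  (proj₁ (Z-step k l t u ≤-refl h))) }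
          ; back-clause = λ { {t , _} {u , _} {v , p} {w , q} (k , h) r → back k t u v w p q h r }
          ; atom-clause = λ { {t , _} {u , _} (k , h) q s →
              let l = k ⊔ (lvl t ⊔ lvl u)
                  ≤l : lvl t ⊔ lvl u ≤ l
                  ≤l = m≤n⊔m k _
              in to-p∞ l (pr (just q) u) (⊔-≤ʳ (lvl t) _ ≤l)
                (Sim-atom (ords (C l) k) (rd (C l) i) (rd (C l) j)
                  (from-p∞ l (zz k t u) ≤-refl h) q
                  (from-p∞ l (pr (just q) t) (⊔-≤ˡ _ (lvl u) ≤l) s)) }
          }
          where
          back : ∀ k (t : Tm F i) (u v w : Tm F j) (p : rep v ≡ v) (q : rep w ≡ w) →
            p∞ (zz k t u) ≡ true → p∞ (rl u v w) ≡ true →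
            ∃₂ λ (b c : W (N i)) → p∞ (rl t (proj₁ b) (proj₁ c)) ≡ true ×
              Z j i (v , p) b × Z i j c (w , q)
          back k t u v w p q h r = cls b , cls c ,
            trans (p∞-cong (rlvl b ⊔ rlvl c) (rl t (rep b) (rep c)) (rl t b c) R-rep)
              (to-p∞ l (rl t b c) (⊔-lub t≤ (⊔-lub b≤ b≤)) (proj₁ spec)) ,
            (suc k , subst (λ v → p∞ (zz (suc k) v (rep b)) ≡ true) p
              (trans (p∞-zz (suc k) v b)
                (to-p∞ l (zz (suc k) v b) (⊔-lub k≤ (⊔-lub v≤ b≤)) (proj₁ (proj₂ spec))))) ,
            (suc k , subst (λ w → p∞ (zz (suc k) (rep c) w) ≡ true) q
              (trans (p∞-zz (suc k) c w)
                (to-p∞ l (zz (suc k) c w) (⊔-lub k≤ (⊔-lub b≤ w≤)) (proj₂ (proj₂ spec)))))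
            where
            b c : Tm F i
            b = back₁ k t v w
            c = back₂ k t v w
            -- The level of `b` is also that of `c` and bounds `suc k`, `t`, `v` and `w`; only `u`,
            -- absent from the back terms, must be added.
            l : ℕ
            l = lvl u ⊔ lvl b
            b≤ : lvl b ≤ l
            b≤ = m≤n⊔m (lvl u) _
            k≤ : suc k ≤ l
            k≤ = ⊔-≤ˡ (suc k) (lvl t ⊔ (lvl v ⊔ lvl w)) b≤
            t≤ : lvl t ≤ l
            t≤ = ⊔-≤ˡ _ (lvl v ⊔ lvl w) (⊔-≤ʳ (suc k) _ b≤)
            v≤ : lvl v ≤ l
            v≤ = ⊔-≤ˡ _ (lvl w) (⊔-≤ʳ (lvl t) _ (⊔-≤ʳ (suc k) _ b≤))
            w≤ : lvl w ≤ l
            w≤ = ⊔-≤ʳ (lvl v) _ (⊔-≤ʳ (lvl t) _ (⊔-≤ʳ (suc k) _ b≤))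
            u≤ : lvl u ≤ l
            u≤ = m≤m⊔n _ _
            D = C l
            spec : Response (model D i) (model D j) (ords D (suc k)) (ev D t) (ev D v) (ev D w)
                     (ev D b , ev D c)
            spec = pick-spec
              (Response (model D i) (model D j) (ords D (suc k)) (ev D t) (ev D v) (ev D w)) _
              (let b′ , c′ , s = proj₂ (Z-step k l t u (⊔-lub k≤ (⊔-lub t≤ u≤)) h)
                                   (from-p∞ l (rl u v w) (⊔-lub u≤ (⊔-lub v≤ w≤)) r)
               in (b′ , c′) , s)
            R-rep : ∀ n → rlvl b ⊔ rlvl c ≤ n →
                    Holds (C n) (rl t (rep b) (rep c)) ≡ Holds (C n) (rl t b c)
            R-rep n le = cong₂ (R (model (C n) i) (ev (C n) t))
              (ev-rep n b (⊔-≤ˡ _ (rlvl c) le)) (ev-rep n c (⊔-≤ʳ (rlvl b) _ le))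

  expand-reduct : (N : Model (Maybe Q)) → expand (reduct N) (V N nothing) ≡ N
  expand-reduct N = cong (λ V′ → record N { V = V′ }) (ext λ { (just q) → refl ; nothing → refl })

  -- A bisimulation that does not respect P

  module NotRespected (φ : Formula (Maybe Q) m) (ψ : Formula (Maybe Q) n)
                      (separated : ∀ α → Separated φ ψ α) where

    -- Skolem symbols for both formulas, so that φ and ψ both pass to the limit.
    Symbol : ℕ → Set
    Symbol k = Binder φ k ⊎ Binder ψ k

    interpretation : ∀ (M : Model (Maybe Q)) {k} → Symbol k → Vec (W M) k → W M
    interpretation M (inj₁ b) = witness φ M b
    interpretation M (inj₂ b) = witness ψ M b

    open Limit {F = Symbol} interpretation
    open Stages (λ N → N ⊨ ψ × N ⊨ φ)
    open Good

    start : ∀ β → Σ (Config Q) (Good 0 β)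
    start β = let N₁ , N₂ , K₁ , K₂ , x , y , Px , ¬Py , sim = separated β in
      record { model = λ { true → N₁ ; false → N₂ }
             ; world = λ { true → x ; false → y }
             -- The conditions of stage 0 concern entry 0; the later entries are placeholders that
             -- truncation overwrites.
             ; ords  = λ _ → β } ,
      record { in-class = λ { true → K₁ ; false → K₂ }
             ; inside   = Px
             ; outside  = ¬Py
             ; similar  = sim
             ; descends = λ _ ()
             ; covers   = λ _ _ → id }

    C : ℕ → Config Q
    C = proj₁ (coherent start)

    good : ∀ n → Good n zeroOrd (C n)
    good = proj₁ (proj₂ (proj₂ (coherent start)))

    open TermModel C (proj₁ (proj₂ (coherent start))) (proj₂ (proj₂ (proj₂ (coherent start))))

    limit : ∀ i → Model Q
    limit i = reduct (N i)

    P∞ : ∀ i → W (N i) → Set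
    P∞ i = V (N i) nothing

    limit⊨ψ : ∀ i → expand (limit i) (P∞ i) ⊨ ψ
    limit⊨ψ i = subst (_⊨ ψ) (sym (expand-reduct (N i)))
      (⊨-limit ψ inj₂ (λ _ _ _ → refl) λ l → proj₁ (in-class (good l) i))

    limit⊨φ : ∀ i → expand (limit i) (P∞ i) ⊨ φ
    limit⊨φ i = subst (_⊨ φ) (sym (expand-reduct (N i)))
      (⊨-limit φ inj₁ (λ _ _ _ → refl) λ l → proj₂ (in-class (good l) i))

    directed : ∀ i j → Directed (limit i) (limit j) (Z i j) (Z j i)
    directed = Z-directed λ n → descends (good n)

    origin : ∀ i → W (N i)
    origin i = cls point

    origins-related : Z true false (origin true) (origin false)
    origins-related = 0 , trans (p∞-zz 0 point point)
      (to-p∞ 0 (zz 0 point point) z≤n (similar (good 0)))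

    bisimulation : IsRelevantDirectedBisimulation (limit true) (limit false)
                     (Z true false) (Z false true)
    bisimulation = record
      { nonempty₁ = origin true , origin false , origins-related
      ; nonempty₂ = star (N false) (origin false) , star (N true) (origin true) ,
                    Directed.star-clause (directed true false)
                      {origin true} {origin false} origins-related
      ; directed₁ = directed true false
      ; directed₂ = directed false true
      }

    -- `point` names the separated worlds at every stage, so the origins are related at index 0
    -- while only the first lies in P.
    not-respected : ¬ BisimulationsRespectP (Mod ψ) φ
    not-respected respects = outside (good 0)
      (from-p∞ 0 (pr nothing point) z≤n (trans (sym (p∞-pr nothing point))
        (Directed.atom-clause (IsRelevantDirectedBisimulation.directed₁ expanded)
          {origin true} {origin false} origins-related nothing
          (trans (p∞-pr nothing point) (to-p∞ 0 (pr nothing point) z≤n (inside (good 0)))))))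
      where
      expanded = respects (limit true) (limit false) (origin true) (origin false)
        (P∞ true) (P∞ false) (limit⊨ψ true) (limit⊨φ true) (limit⊨ψ false) (limit⊨φ false)
        (Z true false) (Z false true) bisimulation

  respects⇒definable : (φ : Formula (Maybe Q) m) (ψ : Formula (Maybe Q) n) →
    BisimulationsRespectP (Mod ψ) φ → ExplicitlyDefinable (Mod ψ) φ
  respects⇒definable φ ψ respects = by-contradiction λ undef →
    NotRespected.not-respected φ ψ (undefinable⇒separated φ ψ undef) respects

corollary15 :
    (∀ {ℓ} → ExcludedMiddle ℓ) →
    (∀ {a b} → Extensionality a b) →
    (PROP : Set) {m n : ℕ}
    (φ : Formula (Maybe PROP) m) (ψ : Formula (Maybe PROP) n) →
    ExplicitlyDefinable (Mod ψ) φ ⇔ BisimulationsRespectP (Mod ψ) φ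
corollary15 em ext PROP φ ψ = mk⇔ (definable⇒respects φ ψ) (respects⇒definable φ ψ)
  where open Classical em ext
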